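{- There is a constant $C>0$ such that for every integer $r>3$ there exists a strongly temporalisable trip network $(D_r,\mathbb{T}_r)$ with $n=r^2+2r$ nodes such that every temporalisation $\tau$ of $(D_r,\mathbb{T}_r)$ has $\tau$-reachability at most $C\,n^{3/2}$.
   Context: A weighted multidigraph $D=(V,E)$ has a finite node set $V$ and a finite multiset $E$ of edges $(u,v,w)$ with weight $w>0$. A trip network is a pair $(D,\mathbb{T})$ where $\mathbb{T}$ is a finite multiset of walks in $D$ (trips); every node and edge of $D$ appears in some trip. A temporalisation $\tau$ assigns a real starting time $\tau(T)$ to each trip. For a trip $T=e_1,\dots,e_k$ with $e_i=(u_i,v_i,w_i)$, it induces temporal edges $(u_i,v_i,\tau(T)+\sum_{j<i}w_j,w_i)$ (tail, head, starting time, travel time). The induced temporal graph $G[D,\mathbb{T},\tau]$ has node set $V$ and all temporal edges induced by all trips. A temporal path from $u$ to $v$ is a sequence of consecutive temporal edges from $u$ to $v$ in which each edge's starting time is at least the arrival time (starting time plus travel time) of the previous one; $v$ is $\tau$-reachable from $u$ if such a path exists in $G[D,\mathbb{T},\tau]$ (every node reaches itself). The $\tau$-reachability of the trip network is the number of ordered pairs $(u,v)$ of nodes with $v$ $\tau$-reachable from $u$. The trip network is strongly temporalisable if for every two nodes $s,t$ there exists a temporalisation $\tau$ (depending on $s,t$) such that $t$ is $\tau$-reachable from $s$.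
   Formalization: The starting times assigned by a temporalisation, and the edge weights, are rational numbers instead of real numbers; so the reachability bound is stated for every temporalisation with rational starting times. -}

module Defs where

open import Data.Nat using (ℕ; _*_; _≤_)
open import Data.Fin using (Fin)
open import Data.Rational as ℚ using (ℚ; Positive; _+_)
open import Data.List using (List; []; _∷_; map; length; concat; lookup; allFin)
open import Data.List.Membership.Propositional using (_∈_)
open import Data.List.Relation.Unary.All using (All)
open import Data.List.Relation.Unary.Unique.Propositional using (Unique)
open import Data.Product using (Σ; _×_; _,_; ∃)
open import Data.Sum using (_⊎_)
open import Data.Unit using (⊤)
open import Relation.Binary.PropositionalEquality using (_≡_)

record Edge (n : ℕ) : Set where
  constructor edge
  field
    tail   : Fin n
    head   : Fin n
    weight : ℚ
    weight>0 : Positive weight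
open Edge public

Chain : ∀ {n} → Fin n → List (Edge n) → Set
Chain u []       = ⊤
Chain u (e ∷ es) = (tail e ≡ u) × Chain (head e) es

Multidigraph : ℕ → Set
Multidigraph n = List (Edge n)

record Walk {n : ℕ} (D : Multidigraph n) : Set where
  constructor walk
  field
    start : Fin n
    steps : List (Fin (length D))
    chain : Chain start (map (lookup D) steps)
open Walk public

walkEdges : ∀ {n} {D : Multidigraph n} → Walk D → List (Edge n)
walkEdges {D = D} T = map (lookup D) (steps T)

NodeOn : ∀ {n} {D : Multidigraph n} → Fin n → Walk D → Set
NodeOn u T = (u ≡ start T) ⊎ (u ∈ map head (walkEdges T))

record TripNetwork (n : ℕ) : Set where
  field
    graph : Multidigraph n
    trips : List (Walk graph)
    nodesCovered : (u : Fin n) → Σ (Fin (length trips)) λ i → NodeOn u (lookup trips i)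
    edgesCovered : (k : Fin (length graph)) →
                   Σ (Fin (length trips)) λ i → k ∈ steps (lookup trips i)
open TripNetwork public

Temporalisation : ∀ {n} → TripNetwork n → Set
Temporalisation N = Fin (length (trips N)) → ℚ

record TEdge (n : ℕ) : Set where
  constructor tedge
  field
    ttail : Fin n
    thead : Fin n
    tstart : ℚ
    ttravel : ℚ
open TEdge public

arrival : ∀ {n} → TEdge n → ℚ
arrival e = tstart e + ttravel e

inducedEdges : ∀ {n} → ℚ → List (Edge n) → List (TEdge n)
inducedEdges t []       = []
inducedEdges t (e ∷ es) = tedge (tail e) (head e) t (weight e) ∷ inducedEdges (t + weight e) es

temporalGraph : ∀ {n} (N : TripNetwork n) → Temporalisation N → List (TEdge n)
temporalGraph N τ =
  concat (map (λ i → inducedEdges (τ i) (walkEdges (lookup (trips N) i))) (allFin (length (trips N))))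

data PathAfter {n : ℕ} (G : List (TEdge n)) : ℚ → Fin n → Fin n → Set where
  stop : ∀ {t u} → PathAfter G t u u
  step : ∀ {t v} (e : TEdge n) → e ∈ G → t ℚ.≤ tstart e →
         PathAfter G (arrival e) (thead e) v → PathAfter G t (ttail e) v

Reachable : ∀ {n} → List (TEdge n) → Fin n → Fin n → Set
Reachable G u v = (u ≡ v) ⊎ Σ (TEdge _) λ e → (e ∈ G) × (ttail e ≡ u) × PathAfter G (arrival e) (thead e) v

τReachable : ∀ {n} (N : TripNetwork n) → Temporalisation N → Fin n → Fin n → Set
τReachable N τ = Reachable (temporalGraph N τ)

StronglyTemporalisable : ∀ {n} → TripNetwork n → Set
StronglyTemporalisable N = ∀ s t → Σ (Temporalisation N) λ τ → τReachable N τ s t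

-- k ≤ C · n^{3/2}, for naturals, expressed without square roots as k² ≤ C² n³.
≤C·n^3/2 : ℕ → ℕ → ℕ → Set
≤C·n^3/2 C n k = k * k ≤ C * C * (n * n * n)

-- the τ-reachability is the number of ordered pairs (u,v) with v τ-reachable from u;
-- we say it is at most C n^{3/2} iff every duplicate-free list of such pairs has
-- length k with k ≤ C n^{3/2}.
ReachabilityAtMostCn3/2 : ∀ {n} (N : TripNetwork n) → Temporalisation N → ℕ → Set
ReachabilityAtMostCn3/2 {n} N τ C =
  (ps : List (Fin n × Fin n)) → Unique ps →
  All (λ p → τReachable N τ (Data.Product.proj₁ p) (Data.Product.proj₂ p)) ps →
  ≤C·n^3/2 C n (length ps)

{-# OPTIONS --safe #-}
module Submission where

-- Each of the r rows has r − 1 members and three hubs p k, m k, l k. The trips, all with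
-- unit weights, are
--   X k : m k → p k → l k → m k              Y k : m k → p k → p (k+1) → m k
--   enter : a → l k  (a a member of row k)   exit : p 0 → v  (v any node).
-- To climb from l k to p k one needs X k to end before Y k starts, and to climb from p (k+1)
-- to p k one needs Y k to end before X k starts. So every single row can be enabled to reach
-- the root p 0, and from there every node; but two rows j < k never simultaneously, since
-- they have contradictory requirements on X j and Y j. A member reaches other members only
-- through the root. Hence a reachable pair starts in a hub (3r choices), or ends in a hub, or
-- starts in the enabled row (r − 1 choices), or is diagonal: at most 7rn pairs.

open import Defs
open import Data.Nat as ℕ using (ℕ; zero; suc; _+_; _*_; _<_)
import Data.Nat.Properties as ℕₚ
open import Data.Nat.Tactic.RingSolver using (solve-∀)
open import Data.Rational as ℚ using (ℚ; 0ℚ; 1ℚ)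
import Data.Rational.Properties as ℚₚ
open import Data.Fin as Fin using (Fin; zero; suc; toℕ; inject₁)
import Data.Fin.Properties as Finₚ
open import Data.Fin.Induction using (<-weakInduction)
open import Data.List using (List; []; _∷_; _++_; map; length; concat; lookup; tabulate; allFin; cartesianProduct)
open import Data.List.Properties using (map-∘; map-cong; length-map; length-++; length-tabulate; lookup-tabulate)
open import Data.List.Membership.Propositional using (_∈_)
open import Data.List.Membership.Propositional.Properties using (∈-map⁺; ∈-map⁻; ∈-++⁺ˡ; ∈-++⁺ʳ; ∈-concat⁺′; ∈-concat⁻′; ∈-allFin; ∈-lookup; ∈-cartesianProduct⁺)
open import Data.List.Relation.Binary.Subset.Propositional using (_⊆_)
open import Data.List.Relation.Unary.All as All using (All)
open import Data.List.Relation.Unary.AllPairs using (_∷_)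
open import Data.List.Relation.Unary.Any using (here; there; index)
open import Data.List.Relation.Unary.Any.Properties using (lookup-index)
open import Data.List.Relation.Unary.Unique.Propositional using (Unique)
open import Data.Empty using (⊥; ⊥-elim)
open import Data.Product using (Σ; ∃; _×_; _,_; proj₁; proj₂)
open import Data.Sum using (_⊎_; inj₁; inj₂)
open import Data.Sum.Function.Propositional using (_⊎-↔_)
open import Data.Unit using (⊤; tt)
open import Function using (_∘_; _↔_; Inverse)
open import Function.Construct.Composition using (_↔-∘_)
open import Function.Construct.Identity using (↔-id)
open import Relation.Binary.Definitions using (tri<; tri≈; tri>)
open import Relation.Binary.PropositionalEquality using (_≡_; _≢_; refl; sym; trans; cong; cong₂; subst; subst₂)
open import Relation.Nullary using (¬_; Dec; yes; no; contradiction)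
open import Relation.Nullary.Decidable using (from-yes; _×-dec_; _→-dec_)

-- Lists

module _ {A : Set} where

  injectʳ : ∀ (xs : List A) {ys} → Fin (length ys) → Fin (length (xs ++ ys))
  injectʳ []       i = i
  injectʳ (x ∷ xs) i = suc (injectʳ xs i)

  lookup-injectʳ : ∀ xs {ys} i → lookup (xs ++ ys) (injectʳ xs i) ≡ lookup ys i
  lookup-injectʳ []       i = refl
  lookup-injectʳ (x ∷ xs) i = lookup-injectʳ xs i

  prefixPositions : (xs ys : List A) → List (Fin (length (xs ++ ys)))
  prefixPositions []       ys = []
  prefixPositions (x ∷ xs) ys = zero ∷ map suc (prefixPositions xs ys)

  lookup-prefixPositions : ∀ xs ys → map (lookup (xs ++ ys)) (prefixPositions xs ys) ≡ xs
  lookup-prefixPositions []       ys = refl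
  lookup-prefixPositions (x ∷ xs) ys =
    cong (x ∷_) (trans (sym (map-∘ (prefixPositions xs ys))) (lookup-prefixPositions xs ys))

  prefix-or-injectʳ : ∀ xs ys (k : Fin (length (xs ++ ys))) →
                      (k ∈ prefixPositions xs ys) ⊎ ∃ λ i → k ≡ injectʳ xs i
  prefix-or-injectʳ []       ys k       = inj₂ (k , refl)
  prefix-or-injectʳ (x ∷ xs) ys zero    = inj₁ (here refl)
  prefix-or-injectʳ (x ∷ xs) ys (suc k) with prefix-or-injectʳ xs ys k
  ... | inj₁ k∈        = inj₁ (there (∈-map⁺ suc k∈))
  ... | inj₂ (i , k≡i) = inj₂ (i , cong suc k≡i)

  -- Walks are lists of positions in the edge list, not of edges. Giving each trip its own block of
  -- one concatenated list puts every edge into a trip and keeps equal edges of different trips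
  -- apart.
  blockPositions : ∀ {m} (f : Fin m → List A) → Fin m → List (Fin (length (concat (tabulate f))))
  blockPositions f zero    = prefixPositions (f zero) (concat (tabulate (f ∘ suc)))
  blockPositions f (suc j) = map (injectʳ (f zero)) (blockPositions (f ∘ suc) j)

  lookup-blockPositions : ∀ {m} (f : Fin m → List A) j →
                          map (lookup (concat (tabulate f))) (blockPositions f j) ≡ f j
  lookup-blockPositions f zero    = lookup-prefixPositions (f zero) _
  lookup-blockPositions f (suc j) =
    trans (sym (map-∘ (blockPositions (f ∘ suc) j)))
      (trans (map-cong (lookup-injectʳ (f zero)) (blockPositions (f ∘ suc) j))
             (lookup-blockPositions (f ∘ suc) j))

  blockPositions-cover : ∀ {m} (f : Fin m → List A) k → ∃ λ j → k ∈ blockPositions f j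
  blockPositions-cover {suc m} f k with prefix-or-injectʳ (f zero) (concat (tabulate (f ∘ suc))) k
  ... | inj₁ k∈ = zero , k∈
  ... | inj₂ (i , refl) with blockPositions-cover (f ∘ suc) i
  ...   | j , i∈ = suc j , ∈-map⁺ (injectʳ (f zero)) i∈

  Unique-lookup-injective : ∀ {xs : List A} → Unique xs → ∀ {i j} → lookup xs i ≡ lookup xs j → i ≡ j
  Unique-lookup-injective (_  ∷ _) {zero}  {zero}  _  = refl
  Unique-lookup-injective (x∉ ∷ _) {zero}  {suc j} eq = contradiction eq (All.lookup x∉ (∈-lookup j))
  Unique-lookup-injective (x∉ ∷ _) {suc i} {zero}  eq = contradiction (sym eq) (All.lookup x∉ (∈-lookup i))
  Unique-lookup-injective (_  ∷ u) {suc i} {suc j} eq = cong suc (Unique-lookup-injective u eq)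

  -- Pigeonhole: sending an index of `xs` to a position of the same element in `ys` is injective,
  -- because the position determines the element and, `xs` being duplicate-free, the element
  -- determines its index.
  Unique-⊆⇒length≤ : ∀ {xs ys : List A} → Unique xs → xs ⊆ ys → length xs ℕ.≤ length ys
  Unique-⊆⇒length≤ {xs} {ys} u xs⊆ys = Finₚ.injective⇒≤ {f = position} λ {i} {j} eq →
    Unique-lookup-injective u
      (trans (lookup-index (xs⊆ys (∈-lookup i)))
        (trans (cong (lookup ys) eq) (sym (lookup-index (xs⊆ys (∈-lookup j))))))
    where
    position : Fin (length xs) → Fin (length ys)
    position i = index (xs⊆ys (∈-lookup i))

  length-cartesianProduct : ∀ {B : Set} (xs : List A) (ys : List B) →
                            length (cartesianProduct xs ys) ≡ length xs * length ys
  length-cartesianProduct []       ys = refl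
  length-cartesianProduct (x ∷ xs) ys =
    trans (length-++ (map (x ,_) ys)) (cong₂ _+_ (length-map (x ,_) ys) (length-cartesianProduct xs ys))

length-map-allFin : ∀ {A : Set} {n} (f : Fin n → A) → length (map f (allFin n)) ≡ n
length-map-allFin {n = n} f = trans (length-map f (allFin n)) (length-tabulate _)

-- Covering the reachable pairs by a short list

module PairCover {A : Set} (all hubs members : List A) where

  -- Overlaps between the four parts are harmless, since the length serves only as an upper bound.
  pairs : List (A × A)
  pairs = cartesianProduct hubs all ++ cartesianProduct all hubs
            ++ cartesianProduct members all ++ map (λ u → u , u) all

  hub-source : ∀ {u v} → u ∈ hubs → v ∈ all → (u , v) ∈ pairs
  hub-source u∈ v∈ = ∈-++⁺ˡ (∈-cartesianProduct⁺ u∈ v∈)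

  hub-target : ∀ {u v} → u ∈ all → v ∈ hubs → (u , v) ∈ pairs
  hub-target u∈ v∈ = ∈-++⁺ʳ (cartesianProduct hubs all) (∈-++⁺ˡ (∈-cartesianProduct⁺ u∈ v∈))

  member-source : ∀ {u v} → u ∈ members → v ∈ all → (u , v) ∈ pairs
  member-source u∈ v∈ = ∈-++⁺ʳ (cartesianProduct hubs all) (∈-++⁺ʳ (cartesianProduct all hubs)
    (∈-++⁺ˡ (∈-cartesianProduct⁺ u∈ v∈)))

  diagonal : ∀ {u} → u ∈ all → (u , u) ∈ pairs
  diagonal u∈ = ∈-++⁺ʳ (cartesianProduct hubs all) (∈-++⁺ʳ (cartesianProduct all hubs)
    (∈-++⁺ʳ (cartesianProduct members all) (∈-map⁺ (λ u → u , u) u∈)))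

  length-pairs : ∀ {n h k} → length all ≡ n → length hubs ≡ h → length members ≡ k →
                 length pairs ≡ h * n + (n * h + (k * n + n))
  length-pairs refl refl refl =
    trans (length-++ (cartesianProduct hubs all)) (cong₂ _+_ (length-cartesianProduct hubs all)
      (trans (length-++ (cartesianProduct all hubs)) (cong₂ _+_ (length-cartesianProduct all hubs)
        (trans (length-++ (cartesianProduct members all))
          (cong₂ _+_ (length-cartesianProduct members all) (length-map (λ u → u , u) all))))))

module ThreeFamilies {A : Set} {r : ℕ} (f g h : Fin r → A) where

  values : List A
  values = map f (allFin r) ++ map g (allFin r) ++ map h (allFin r)

  ∈-values₁ : ∀ k → f k ∈ values
  ∈-values₁ k = ∈-++⁺ˡ (∈-map⁺ f (∈-allFin k))

  ∈-values₂ : ∀ k → g k ∈ values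
  ∈-values₂ k = ∈-++⁺ʳ (map f (allFin r)) (∈-++⁺ˡ (∈-map⁺ g (∈-allFin k)))

  ∈-values₃ : ∀ k → h k ∈ values
  ∈-values₃ k = ∈-++⁺ʳ (map f (allFin r)) (∈-++⁺ʳ (map g (allFin r)) (∈-map⁺ h (∈-allFin k)))

  length-values : length values ≡ r + (r + r)
  length-values = trans (length-++ (map f (allFin r))) (cong₂ _+_ (length-map-allFin f)
    (trans (length-++ (map g (allFin r))) (cong₂ _+_ (length-map-allFin g) (length-map-allFin h))))

-- Trip networks from families of trips

module FromFamily {n m : ℕ} {I : Set} (enum : Fin m ↔ I)
                  (first : I → Fin n) (edges : I → List (Edge n)) (isChain : ∀ i → Chain (first i) (edges i))
                  (cover : ∀ u → Σ I λ i → (u ≡ first i) ⊎ (u ∈ map head (edges i))) where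

  open Inverse enum using (to; from; strictlyInverseˡ; strictlyInverseʳ)

  blocks : Fin m → List (Edge n)
  blocks j = edges (to j)

  network-graph : Multidigraph n
  network-graph = concat (tabulate blocks)

  trip : Fin m → Walk network-graph
  trip j = walk (first (to j)) (blockPositions blocks j)
                (subst (Chain (first (to j))) (sym (lookup-blockPositions blocks j)) (isChain (to j)))

  walkEdges-trip : ∀ j → walkEdges (trip j) ≡ edges (to j)
  walkEdges-trip = lookup-blockPositions blocks

  tripIndex : Fin m → Fin (length (tabulate trip))
  tripIndex = Fin.cast (sym (length-tabulate trip))

  tripNumber : Fin (length (tabulate trip)) → Fin m
  tripNumber = Fin.cast (length-tabulate trip)

  tripIndex-tripNumber : ∀ i → tripIndex (tripNumber i) ≡ i
  tripIndex-tripNumber = Finₚ.cast-involutive (sym (length-tabulate trip)) (length-tabulate trip)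

  tripNumber-tripIndex : ∀ j → tripNumber (tripIndex j) ≡ j
  tripNumber-tripIndex = Finₚ.cast-involutive (length-tabulate trip) (sym (length-tabulate trip))

  lookup-trip : ∀ j → lookup (tabulate trip) (tripIndex j) ≡ trip j
  lookup-trip = lookup-tabulate trip

  trip-on : ∀ u i → (u ≡ first i) ⊎ (u ∈ map head (edges i)) → NodeOn u (trip (from i))
  trip-on u i on rewrite walkEdges-trip (from i) | strictlyInverseˡ i = on

  network : TripNetwork n
  network = record
    { graph        = network-graph
    ; trips        = tabulate trip
    ; nodesCovered = λ u → let i , on = cover u in
        tripIndex (from i) , subst (NodeOn u) (sym (lookup-trip (from i))) (trip-on u i on)
    ; edgesCovered = λ k → let j , k∈ = blockPositions-cover blocks k in
        tripIndex j , subst (λ T → k ∈ steps T) (sym (lookup-trip j)) k∈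
    }

  startOf : Temporalisation network → I → ℚ
  startOf τ i = τ (tripIndex (from i))

  startingAt : (I → ℚ) → Temporalisation network
  startingAt θ i = θ (to (tripNumber i))

  startOf-startingAt : ∀ θ i → startOf (startingAt θ) i ≡ θ i
  startOf-startingAt θ i = cong θ (trans (cong to (tripNumber-tripIndex (from i))) (strictlyInverseˡ i))

  induced : Temporalisation network → Fin (length (tabulate trip)) → List (TEdge n)
  induced τ i = inducedEdges (τ i) (walkEdges (lookup (tabulate trip) i))

  induced≡ : ∀ τ i → induced τ i ≡ inducedEdges (τ i) (edges (to (tripNumber i)))
  induced≡ τ i = cong (inducedEdges (τ i))
    (subst (λ i′ → walkEdges (lookup (tabulate trip) i′) ≡ edges (to (tripNumber i)))
           (tripIndex-tripNumber i)
           (trans (cong walkEdges (lookup-trip (tripNumber i))) (walkEdges-trip (tripNumber i))))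

  -- Together with `∈-temporalGraph⁻` this hides the list positions of trips: from here on a trip is
  -- an element of `I`, which can be matched on by kind.
  ∈-temporalGraph⁺ : ∀ τ i {e} → e ∈ inducedEdges (startOf τ i) (edges i) → e ∈ temporalGraph network τ
  ∈-temporalGraph⁺ τ i {e} e∈ = ∈-concat⁺′ e∈induced (∈-map⁺ (induced τ) (∈-allFin j))
    where
    j = tripIndex (from i)
    e∈induced : e ∈ induced τ j
    e∈induced = subst (e ∈_) (sym (trans (induced≡ τ j) (cong (inducedEdges (τ j) ∘ edges)
      (trans (cong to (tripNumber-tripIndex (from i))) (strictlyInverseˡ i))))) e∈

  ∈-temporalGraph⁻ : ∀ τ {e} → e ∈ temporalGraph network τ →
                     ∃ λ i → e ∈ inducedEdges (startOf τ i) (edges i)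
  ∈-temporalGraph⁻ τ {e} e∈ with ∈-concat⁻′ (map (induced τ) (allFin _)) e∈
  ... | es , e∈es , es∈ with ∈-map⁻ (induced τ) es∈
  ...   | j , _ , refl = to (tripNumber j) ,
          subst (λ t → e ∈ inducedEdges t (edges (to (tripNumber j))))
            (sym (cong τ (trans (cong tripIndex (strictlyInverseʳ (tripNumber j))) (tripIndex-tripNumber j))))
            (subst (e ∈_) (induced≡ τ j) e∈es)

PathAfter-earlier : ∀ {n} {G : List (TEdge n)} {t t′ u v} → t′ ℚ.≤ t → PathAfter G t u v → PathAfter G t′ u v
PathAfter-earlier t′≤t stop             = stop
PathAfter-earlier t′≤t (step e e∈ le π) = step e e∈ (ℚₚ.≤-trans t′≤t le) π

PathAfter⇒Reachable : ∀ {n} {G : List (TEdge n)} {t u v} → PathAfter G t u v → Reachable G u v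
PathAfter⇒Reachable stop            = inj₁ refl
PathAfter⇒Reachable (step e e∈ _ π) = inj₂ (e , e∈ , refl , π)

-- Rational inequalities

-- Arrival time of a trip of three unit edges that starts at `t`. The left-nested sum is the form
-- that `inducedEdges` produces, so it agrees with `arrival` by computation.
after : ℚ → ℚ
after t = t ℚ.+ 1ℚ ℚ.+ 1ℚ ℚ.+ 1ℚ

<-+1 : ∀ t → t ℚ.< t ℚ.+ 1ℚ
<-+1 t = subst (ℚ._< t ℚ.+ 1ℚ) (ℚₚ.+-identityʳ t) (ℚₚ.+-monoʳ-< t (from-yes (0ℚ ℚₚ.<? 1ℚ)))

after≰ : ∀ {t} → ¬ (after t ℚ.≤ t)
after≰ {t} le = ℚₚ.<-irrefl refl (ℚₚ.<-≤-trans
  (ℚₚ.<-trans (<-+1 t) (ℚₚ.<-trans (<-+1 (t ℚ.+ 1ℚ)) (<-+1 (t ℚ.+ 1ℚ ℚ.+ 1ℚ)))) le)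

≤-after : ∀ t → t ℚ.≤ after t
≤-after t = ℚₚ.<⇒≤ (ℚₚ.≰⇒> after≰)

before : ℚ → ℚ
before t = t ℚ.- 1ℚ ℚ.- 1ℚ ℚ.- 1ℚ

-1+1 : ∀ t → t ℚ.- 1ℚ ℚ.+ 1ℚ ≡ t
-1+1 t = trans (ℚₚ.+-assoc t (ℚ.- 1ℚ) 1ℚ) (ℚₚ.+-identityʳ t)

after-before : ∀ t → after (before t) ≡ t
after-before t = trans (cong (λ s → s ℚ.+ 1ℚ ℚ.+ 1ℚ) (-1+1 (t ℚ.- 1ℚ ℚ.- 1ℚ)))
  (trans (cong (λ s → s ℚ.+ 1ℚ) (-1+1 (t ℚ.- 1ℚ))) (-1+1 t))

-- The gadget network

module Gadget (q : ℕ) where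

  rows : ℕ
  rows = suc q

  -- With r = q + 1 this is r (r + 2). The product form lets nodes correspond to pairs of a row and
  -- a column; the columns are three hubs and q = r - 1 members.
  n : ℕ
  n = rows * (3 + q)

  Label : Set
  Label = Fin rows × Fin (3 + q)

  pattern p k   = k , zero
  pattern m k   = k , suc zero
  pattern l k   = k , suc (suc zero)
  pattern a k c = k , suc (suc (suc c))

  open Inverse (Finₚ.*↔× {rows} {3 + q}) using ()
    renaming (to to label; from to node; strictlyInverseˡ to label-node; strictlyInverseʳ to node-label)

  -- The last row has no row below it; its trip Y has a loop at p in place of the edge to the next row.
  next : ∀ {q} → Fin (suc q) → Fin (suc q)
  next {zero}  i       = i
  next {suc q} zero    = suc zero
  next {suc q} (suc i) = suc (next i)

  next-inject₁ : ∀ {q} (j : Fin q) → next (inject₁ j) ≡ suc j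
  next-inject₁ zero          = refl
  next-inject₁ (suc zero)    = cong suc (next-inject₁ zero)
  next-inject₁ (suc (suc j)) = cong suc (next-inject₁ (suc j))

  ≤-next : ∀ {q} (i : Fin (suc q)) → i Fin.≤ next i
  ≤-next {zero}  i       = ℕₚ.≤-refl
  ≤-next {suc q} zero    = ℕ.z≤n
  ≤-next {suc q} (suc i) = ℕ.s≤s (≤-next i)

  next-≤ : ∀ {q} (i : Fin (suc q)) → toℕ (next i) ℕ.≤ suc (toℕ i)
  next-≤ {zero}  i       = ℕₚ.n≤1+n _
  next-≤ {suc q} zero    = ℕₚ.≤-refl
  next-≤ {suc q} (suc i) = ℕ.s≤s (next-≤ i)

  Trip : Set
  Trip = Fin rows ⊎ (Fin rows ⊎ ((Fin rows × Fin q) ⊎ Fin n))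

  pattern X k       = inj₁ k
  pattern Y k       = inj₂ (inj₁ k)
  pattern enter k c = inj₂ (inj₂ (inj₁ (k , c)))
  pattern exit v    = inj₂ (inj₂ (inj₂ v))

  enum : Fin (rows + (rows + (rows * q + n))) ↔ Trip
  enum = (↔-id _ ⊎-↔ ((↔-id _ ⊎-↔ ((Finₚ.*↔× ⊎-↔ ↔-id _) ↔-∘ Finₚ.+↔⊎)) ↔-∘ Finₚ.+↔⊎)) ↔-∘ Finₚ.+↔⊎

  arc : Fin n → Fin n → Edge n
  arc u v = edge u v 1ℚ _

  root : Fin n
  root = node (p zero)

  first : Trip → Fin n
  first (X k)       = node (m k)
  first (Y k)       = node (m k)
  first (enter k c) = node (a k c)
  first (exit v)    = root

  edges : Trip → List (Edge n)
  edges (X k)       = arc (node (m k)) (node (p k)) ∷ arc (node (p k)) (node (l k)) ∷ arc (node (l k)) (node (m k)) ∷ []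
  edges (Y k)       = arc (node (m k)) (node (p k)) ∷ arc (node (p k)) (node (p (next k))) ∷ arc (node (p (next k))) (node (m k)) ∷ []
  edges (enter k c) = arc (node (a k c)) (node (l k)) ∷ []
  edges (exit v)    = arc root v ∷ []

  isChain : ∀ i → Chain (first i) (edges i)
  isChain (X k)       = refl , refl , refl , tt
  isChain (Y k)       = refl , refl , refl , tt
  isChain (enter k c) = refl , tt
  isChain (exit v)    = refl , tt

  open FromFamily enum first edges isChain (λ u → exit u , inj₂ (here refl)) public

  -- Enabling one row

  -- The climb to the root passes row k during the times from base k − 3 to base k + 4.
  base : ℕ → ℚ
  base zero    = 0ℚ
  base (suc k) = before (base k ℚ.- 1ℚ)

  -- As `Y k` starts at `base` in every row, the choice is whether `X k` ends just when `Y k` starts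
  -- (row `K`, to climb from `l`) or starts just when `Y k` ends (other rows, to climb from the row
  -- below).
  xStart : (K k : Fin rows) → ℚ
  xStart K k with k Fin.≟ K
  ... | yes _ = before (base (toℕ k))
  ... | no  _ = after (base (toℕ k))

  schedule : Fin rows → Trip → ℚ
  schedule K (X k)       = xStart K k
  schedule K (Y k)       = base (toℕ k)
  schedule K (enter k c) = before (base (toℕ k))
  -- This is `base 0` + 4, the time by which every climb stands at the root.
  schedule K (exit v)    = after 0ℚ ℚ.+ 1ℚ

  module Climb (K : Fin rows) (v : Fin n) where

    τ : Temporalisation network
    τ = startingAt (schedule K)

    G : List (TEdge n)
    G = temporalGraph network τ

    scheduled : ∀ i {e} → e ∈ inducedEdges (schedule K i) (edges i) → e ∈ G
    scheduled i {e} e∈ = ∈-temporalGraph⁺ τ i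
      (subst (λ t → e ∈ inducedEdges t (edges i)) (sym (startOf-startingAt (schedule K) i)) e∈)

    -- Invariant for an induction from the root downwards. It stops at `K`, because in row `K`
    -- itself `X` precedes `Y` and no lower row can climb through it.
    Climbs : Fin rows → Set
    Climbs k = k Fin.≤ K → PathAfter G (after (base (toℕ k)) ℚ.+ 1ℚ) (node (p k)) v

    xStart-≢ : ∀ {k} → k ≢ K → xStart K k ≡ after (base (toℕ k))
    xStart-≢ {k} k≢K with k Fin.≟ K
    ... | yes k≡K = contradiction k≡K k≢K
    ... | no  _   = refl

    xStart-≡ : xStart K K ≡ before (base (toℕ K))
    xStart-≡ with K Fin.≟ K
    ... | yes _   = refl
    ... | no  K≢K = contradiction refl K≢K

    -- With i = `inject₁ j`, the third edge of `Y i` leads from `p (i+1)` to `m i`, arriving exactly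
    -- when `X i` departs; the first edge of `X i` then leads to `p i`.
    climb-step : (j : Fin q) → Climbs (inject₁ j) → Climbs (suc j)
    climb-step j climbs j<K =
      subst₂ (λ b k → PathAfter G (after (before (b ℚ.- 1ℚ)) ℚ.+ 1ℚ) (node (p k)) v)
        (cong base (Finₚ.toℕ-inject₁ j)) (next-inject₁ j)
        (step _ (scheduled (Y i) (there (there (here refl)))) on-Y
          (step _ (scheduled (X i) (here refl)) on-X (PathAfter-earlier off-X (climbs (ℕₚ.<⇒≤ i<K)))))
      where
      i = inject₁ j
      b = base (toℕ i)
      i<K : i Fin.< K
      i<K = subst (ℕ._< toℕ K) (sym (Finₚ.toℕ-inject₁ j)) j<K
      x≡ : xStart K i ≡ after b
      x≡ = xStart-≢ (Finₚ.<⇒≢ i<K)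
      -- The row below is done at `base (i+1)` + 4 = `b`, two units before the third edge of `Y i`
      -- leaves.
      on-Y : after (before (b ℚ.- 1ℚ)) ℚ.+ 1ℚ ℚ.≤ b ℚ.+ 1ℚ ℚ.+ 1ℚ
      on-Y = ℚₚ.≤-trans (ℚₚ.≤-reflexive (trans (cong (ℚ._+ 1ℚ) (after-before (b ℚ.- 1ℚ))) (-1+1 b)))
        (ℚₚ.<⇒≤ (ℚₚ.<-trans (<-+1 b) (<-+1 (b ℚ.+ 1ℚ))))
      on-X : after b ℚ.≤ xStart K i
      on-X = ℚₚ.≤-reflexive (sym x≡)
      off-X : xStart K i ℚ.+ 1ℚ ℚ.≤ after b ℚ.+ 1ℚ
      off-X = ℚₚ.≤-reflexive (cong (ℚ._+ 1ℚ) x≡)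

    climbs : ∀ k → Climbs k
    climbs = <-weakInduction Climbs
      (λ _ → step _ (scheduled (exit v) (here refl)) ℚₚ.≤-refl stop) climb-step

    b = base (toℕ K)

    -- The first edge of `Y K` reaches `p K` at `b` + 1; waiting there until `b` + 4 joins the
    -- climb.
    from-m : PathAfter G b (node (m K)) v
    from-m = step _ (scheduled (Y K) (here refl)) ℚₚ.≤-refl
      (PathAfter-earlier (ℚₚ.+-monoˡ-≤ 1ℚ (≤-after b)) (climbs K ℕₚ.≤-refl))

    from-l : PathAfter G (xStart K K ℚ.+ 1ℚ ℚ.+ 1ℚ) (node (l K)) v
    from-l = step _ (scheduled (X K) (there (there (here refl)))) ℚₚ.≤-refl (PathAfter-earlier on-Y from-m)
      where
      on-Y : after (xStart K K) ℚ.≤ b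
      on-Y = ℚₚ.≤-reflexive (trans (cong after xStart-≡) (after-before b))

    from-row : ∀ c → Reachable G (node (K , c)) v
    from-row zero                = PathAfter⇒Reachable (climbs K ℕₚ.≤-refl)
    from-row (suc zero)          = PathAfter⇒Reachable from-m
    from-row (suc (suc zero))    = PathAfter⇒Reachable from-l
    from-row (suc (suc (suc c))) = PathAfter⇒Reachable
      (step {t = schedule K (enter K c)} _ (scheduled (enter K c) (here refl)) ℚₚ.≤-refl (PathAfter-earlier on-X from-l))
      where
      on-X : schedule K (enter K c) ℚ.+ 1ℚ ℚ.≤ xStart K K ℚ.+ 1ℚ ℚ.+ 1ℚ
      on-X = subst (λ t → schedule K (enter K c) ℚ.+ 1ℚ ℚ.≤ t ℚ.+ 1ℚ ℚ.+ 1ℚ) (sym xStart-≡) (ℚₚ.<⇒≤ (<-+1 _))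

  stronglyTemporalisable : StronglyTemporalisable network
  stronglyTemporalisable s t = τ , subst (λ u → Reachable G u t) (node-label s) (from-row (proj₂ (label s)))
    where open Climb (proj₁ (label s)) t

  -- At most one row is enabled

  module Moves (x y : Fin rows → ℚ) where

    -- The moves over-approximate the temporal graph: `e₁` and `o₁` may happen at any time. The
    -- obstruction comes from the times of `X` and `Y` alone.
    data Move : ℚ → ℚ → Label → Label → Set where
      x₁ : ∀ k → Move (x k) (x k ℚ.+ 1ℚ) (m k) (p k)
      x₂ : ∀ k → Move (x k ℚ.+ 1ℚ) (x k ℚ.+ 1ℚ ℚ.+ 1ℚ) (p k) (l k)
      x₃ : ∀ k → Move (x k ℚ.+ 1ℚ ℚ.+ 1ℚ) (after (x k)) (l k) (m k)
      y₁ : ∀ k → Move (y k) (y k ℚ.+ 1ℚ) (m k) (p k)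
      y₂ : ∀ k → Move (y k ℚ.+ 1ℚ) (y k ℚ.+ 1ℚ ℚ.+ 1ℚ) (p k) (p (next k))
      y₃ : ∀ k → Move (y k ℚ.+ 1ℚ ℚ.+ 1ℚ) (after (y k)) (p (next k)) (m k)
      e₁ : ∀ k c {s t} → Move s t (a k c) (l k)
      o₁ : ∀ v {s t} → Move s t (p zero) v

    data Path : ℚ → Label → Label → Set where
      stop : ∀ {t u} → Path t u u
      step : ∀ {t s s′ u v w} → Move s s′ u v → t ℚ.≤ s → Path s′ v w → Path t u w

    -- From m k one can only leave with the first edge of X k or Y k.
    from-m-after-X : ∀ {k k′ c t} → after (x k) ℚ.≤ t → Path t (m k) (a k′ c) → after (x k) ℚ.≤ y k
    from-m-after-X x≤t (step (x₁ k) t≤ _) = contradiction (ℚₚ.≤-trans x≤t t≤) after≰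
    from-m-after-X x≤t (step (y₁ k) t≤ _) = ℚₚ.≤-trans x≤t t≤

    from-m-after-Y : ∀ {k k′ c t} → after (y k) ℚ.≤ t → Path t (m k) (a k′ c) → after (y k) ℚ.≤ x k
    from-m-after-Y y≤t (step (x₁ k) t≤ _) = ℚₚ.≤-trans y≤t t≤
    from-m-after-Y y≤t (step (y₁ k) t≤ _) = contradiction (ℚₚ.≤-trans y≤t t≤) after≰

    -- The only way out of `l k` is the third edge of `X k`, which reaches `m k` just when `X k` is
    -- over.
    from-l : ∀ {k k′ c t} → Path t (l k) (a k′ c) → after (x k) ℚ.≤ y k
    from-l (step (x₃ k) _ π) = from-m-after-X ℚₚ.≤-refl π

    -- Rules out the empty path from a member to itself, for which `from-below` would fail.
    IsHub : Fin (3 + q) → Set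
    IsHub (suc (suc (suc _))) = ⊥
    IsHub _                   = ⊤

    -- Members are entered only from the root, so the path must leave the rows below `k`. Only third
    -- edges of `Y` trips lead up, one row at a time; hence the path takes that of `Y k` and stands
    -- at `m k` when `Y k` is over.
    from-below : ∀ {k i d k′ c t} → k Fin.< i → IsHub d → Path t (i , d) (a k′ c) → after (y k) ℚ.≤ x k
    from-below k<i hub (step (x₁ i) _ π) = from-below k<i _ π
    from-below k<i hub (step (x₂ i) _ π) = from-below k<i _ π
    from-below k<i hub (step (x₃ i) _ π) = from-below k<i _ π
    from-below k<i hub (step (y₁ i) _ π) = from-below k<i _ π
    from-below k<i hub (step (y₂ i) _ π) = from-below (ℕₚ.<-≤-trans k<i (≤-next i)) _ π
    from-below {k} k<i hub (step (y₃ j) _ π) with Finₚ.<-cmp k j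
    ... | tri< k<j _ _  = from-below k<j _ π
    ... | tri≈ _ refl _ = from-m-after-Y ℚₚ.≤-refl π
    -- For j < k the third edge of `Y j` starts in a row at most j + 1 ≤ k, which is not below `k`.
    ... | tri> _ _ j<k  = contradiction (ℕₚ.<-≤-trans k<i (next-≤ j)) (ℕₚ.≤⇒≯ j<k)

    -- A necessary condition for a member of row `k` to reach another member, decidable from the
    -- times of `X` and `Y`.
    Enabled : Fin rows → Set
    Enabled k = (after (x k) ℚ.≤ y k) × (∀ i → i Fin.< k → after (y i) ℚ.≤ x i)

    enabled? : ∀ k → Dec (Enabled k)
    enabled? k = (after (x k) ℚₚ.≤? y k) ×-dec
      Finₚ.all? λ i → (i Finₚ.<? k) →-dec (after (y i) ℚₚ.≤? x i)

    not-both-orders : ∀ {k} → after (x k) ℚ.≤ y k → ¬ (after (y k) ℚ.≤ x k)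
    not-both-orders {k} x≤y y≤x = after≰ (ℚₚ.≤-trans x≤y (ℚₚ.≤-trans (≤-after (y k)) y≤x))

    Enabled-unique : ∀ {j k} → Enabled j → Enabled k → j ≡ k
    Enabled-unique {j} {k} (xj , yj) (xk , yk) with Finₚ.<-cmp j k
    ... | tri< j<k _ _ = ⊥-elim (not-both-orders xj (yk j j<k))
    ... | tri≈ _ j≡k _ = j≡k
    ... | tri> _ _ k<j = ⊥-elim (not-both-orders xk (yj k k<j))

    -- If no row is enabled, the row returned is arbitrary.
    enabledRow : ∃ λ k⋆ → ∀ k → Enabled k → k ≡ k⋆
    enabledRow with Finₚ.any? enabled?
    ... | yes (k⋆ , enabled) = k⋆ , λ k enabled′ → Enabled-unique enabled′ enabled
    ... | no  none           = zero , λ k enabled → contradiction (k , enabled) none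

    k⋆ : Fin rows
    k⋆ = proj₁ enabledRow

    -- After the forced move to `l k`, the same path yields both halves: leaving `l k` fixes the
    -- order in row `k`, and `l k` lies below every row i < k.
    member-enabled : ∀ {s t u v k c k′ c′} → Move s t (a k c) u → Path t u v → v ≡ a k′ c′ → Enabled k
    member-enabled (e₁ k c) π refl = from-l π , λ i i<k → from-below i<k _ π

  -- Bounding the number of reachable pairs

  module Bound (τ : Temporalisation network) where

    open Moves (λ k → startOf τ (X k)) (λ k → startOf τ (Y k))

    relabel : ∀ {s t} u v → Move s t u v → Move s t (label (node u)) (label (node v))
    relabel u v = subst₂ (Move _ _) (sym (label-node u)) (sym (label-node v))

    exitMove : ∀ {s t} v → Move s t (label root) v
    exitMove {s} {t} v = subst (λ u → Move s t u v) (sym (label-node (p zero))) (o₁ v)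

    inducedMove : ∀ i {e} → e ∈ inducedEdges (startOf τ i) (edges i) →
                  Move (tstart e) (arrival e) (label (ttail e)) (label (thead e))
    inducedMove (X k)       (here refl)                 = relabel (m k) (p k) (x₁ k)
    inducedMove (X k)       (there (here refl))         = relabel (p k) (l k) (x₂ k)
    inducedMove (X k)       (there (there (here refl))) = relabel (l k) (m k) (x₃ k)
    inducedMove (Y k)       (here refl)                 = relabel (m k) (p k) (y₁ k)
    inducedMove (Y k)       (there (here refl))         = relabel (p k) (p (next k)) (y₂ k)
    inducedMove (Y k)       (there (there (here refl))) = relabel (p (next k)) (m k) (y₃ k)
    inducedMove (enter k c) (here refl)                 = relabel (a k c) (l k) (e₁ k c)
    inducedMove (exit v)    (here refl)                 = exitMove (label v)

    move : ∀ {e} → e ∈ temporalGraph network τ → Move (tstart e) (arrival e) (label (ttail e)) (label (thead e))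
    move e∈ = let i , e∈trip = ∈-temporalGraph⁻ τ e∈ in inducedMove i e∈trip

    path : ∀ {t u v} → PathAfter (temporalGraph network τ) t u v → Path t (label u) (label v)
    path stop             = stop
    path (step e e∈ le π) = step (move e∈) le (path π)

    member-reaches : ∀ {u v k c k′ c′} → label u ≡ a k c → label v ≡ a k′ c′ →
                     τReachable network τ u v → (u ≡ v) ⊎ Enabled k
    member-reaches u≡ v≡ (inj₁ u≡v) = inj₁ u≡v
    member-reaches u≡ v≡ (inj₂ (e , e∈ , refl , π)) =
      inj₂ (member-enabled (subst (λ u → Move _ _ u (label (thead e))) u≡ (move e∈)) (path π) v≡)

    open ThreeFamilies (λ k → node (p k)) (λ k → node (m k)) (λ k → node (l k)) renaming (values to hubs)

    rowMembers : List (Fin n)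
    rowMembers = map (λ c → node (a k⋆ c)) (allFin q)

    open PairCover (allFin n) hubs rowMembers

    ∈-by-label : ∀ {xs u w} → label u ≡ w → node w ∈ xs → u ∈ xs
    ∈-by-label {xs} {u} u≡w = subst (_∈ xs) (trans (cong node (sym u≡w)) (node-label u))

    -- The label is passed as a separate `w` with an equation so that it can be matched on.
    hub-or-member : ∀ u w → label u ≡ w → (u ∈ hubs) ⊎ ∃ λ k → ∃ λ c → label u ≡ a k c
    hub-or-member u (p k)   u≡ = inj₁ (∈-by-label u≡ (∈-values₁ k))
    hub-or-member u (m k)   u≡ = inj₁ (∈-by-label u≡ (∈-values₂ k))
    hub-or-member u (l k)   u≡ = inj₁ (∈-by-label u≡ (∈-values₃ k))
    hub-or-member u (a k c) u≡ = inj₂ (k , c , u≡)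

    ∈-rowMembers : ∀ {u k c} → label u ≡ a k c → k ≡ k⋆ → u ∈ rowMembers
    ∈-rowMembers {c = c} u≡ refl = ∈-by-label u≡ (∈-map⁺ (λ c → node (a k⋆ c)) (∈-allFin c))

    reachable-pair : ∀ u v → τReachable network τ u v → (u , v) ∈ pairs
    reachable-pair u v reach = cases (hub-or-member u _ refl) (hub-or-member v _ refl)
      where
      from-member : ∀ {k c} → label u ≡ a k c → (u ≡ v) ⊎ Enabled k → (u , v) ∈ pairs
      from-member u≡ (inj₁ u≡v)     = subst (λ w → (u , w) ∈ pairs) u≡v (diagonal (∈-allFin u))
      from-member u≡ (inj₂ enabled) =
        member-source (∈-rowMembers u≡ (proj₂ enabledRow _ enabled)) (∈-allFin v)

      cases : (u ∈ hubs) ⊎ (∃ λ k → ∃ λ c → label u ≡ a k c) →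
              (v ∈ hubs) ⊎ (∃ λ k → ∃ λ c → label v ≡ a k c) → (u , v) ∈ pairs
      cases (inj₁ u∈)           _                   = hub-source u∈ (∈-allFin v)
      cases (inj₂ _)            (inj₁ v∈)           = hub-target (∈-allFin u) v∈
      cases (inj₂ (_ , _ , u≡)) (inj₂ (_ , _ , v≡)) = from-member u≡ (member-reaches u≡ v≡ reach)

    -- Source of the constant 7: the 3r hubs give 3rn pairs as sources and 3rn as targets; the r - 1
    -- members of row `k⋆` and the diagonal give rn more.
    count : ∀ q n → let r = suc q in
            (r + (r + r)) * n + (n * (r + (r + r)) + (q * n + n)) ≡ 7 * (r * n)
    count = solve-∀

    pairs-count : length pairs ≡ 7 * (rows * n)
    pairs-count = trans
      (length-pairs (length-tabulate {n = n} (λ u → u)) length-values (length-map-allFin (λ c → node (a k⋆ c))))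
      (count q n)

    square : ∀ r n → 7 * (r * n) * (7 * (r * n)) ≡ 49 * (r * r * (n * n))
    square = solve-∀

    reachability≤ : ReachabilityAtMostCn3/2 network τ 7
    reachability≤ ps unique reach = begin
      length ps * length ps             ≤⟨ ℕₚ.*-mono-≤ ps≤ ps≤ ⟩
      7 * (rows * n) * (7 * (rows * n)) ≡⟨ square rows n ⟩
      -- Since n = r (r + 2) is at least r², the factor r² n² is at most n³.
      49 * (rows * rows * (n * n))      ≤⟨ ℕₚ.*-monoʳ-≤ 49 (ℕₚ.*-monoˡ-≤ (n * n) rows²≤n) ⟩
      49 * (n * (n * n))                ≡⟨ cong (49 *_) (sym (ℕₚ.*-assoc n n n)) ⟩
      49 * (n * n * n)                  ∎
      where
      open ℕₚ.≤-Reasoning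
      ps≤ : length ps ℕ.≤ 7 * (rows * n)
      ps≤ = subst (length ps ℕ.≤_) pairs-count
        (Unique-⊆⇒length≤ unique λ p∈ → reachable-pair _ _ (All.lookup reach p∈))
      rows²≤n : rows * rows ℕ.≤ n
      rows²≤n = ℕₚ.*-monoʳ-≤ rows (ℕₚ.+-monoˡ-≤ q (ℕ.s≤s ℕ.z≤n))

theorem5 : Σ ℕ λ C → (0 < C) × ((r : ℕ) → 3 < r →
    Σ (TripNetwork (r * r + 2 * r)) λ N → StronglyTemporalisable N ×
    ((τ : Temporalisation N) → ReachabilityAtMostCn3/2 N τ C))
theorem5 = 7 , ℕ.z<s , networks
  where
  node-count : ∀ q → suc q * (3 + q) ≡ suc q * suc q + 2 * suc q
  node-count = solve-∀

  networks : (r : ℕ) → 3 < r → Σ (TripNetwork (r * r + 2 * r)) λ N → StronglyTemporalisable N ×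
    ((τ : Temporalisation N) → ReachabilityAtMostCn3/2 N τ 7)
  -- `Gadget q` has (q + 1)(q + 3) nodes, which equals r² + 2r only by a ring identity; hence the
  -- transport.
  networks (suc q) _ = subst
    (λ n → Σ (TripNetwork n) λ N → StronglyTemporalisable N × ((τ : Temporalisation N) → ReachabilityAtMostCn3/2 N τ 7))
    (node-count q)
    (Gadget.network q , Gadget.stronglyTemporalisable q , Gadget.Bound.reachability≤ q)
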